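{- For every $k\in\mathbb{N}$ there is a CBGT instance $(E,\mathcal{I},g)$ with $n=|E|=\binom{2k}{k}$ elements such that every infinite valid schedule $\pi$ for it satisfies $h(\pi)\ge\frac14\log_2 n$.
   Context: An instance of Combinatorial Bamboo Garden Trimming (CBGT) is a triple $(E,\mathcal{I},g)$ where $E$ is a finite set (of "bamboos"), $\mathcal{I}\subseteq 2^E$ is a family of subsets of $E$, and $g\in\mathbb{Q}_{\ge 0}^E$ is a vector of growth rates such that there are coefficients $\lambda(I)\ge 0$ ($I\in\mathcal{I}$) with $\sum_{I\in\mathcal{I}}\lambda(I)=1$ and $g(e)=\sum_{I\in\mathcal{I}:\, e\in I}\lambda(I)$ for every $e\in E$. Let $\mathbb{N}=\{1,2,\dots\}$. An infinite schedule is a sequence $\pi=\pi(1),\pi(2),\dots$ of subsets of $E$; it is valid if $\pi(t)\in\mathcal{I}$ for all $t\in\mathbb{N}$. $h^\pi_t(e)$ denotes the height of $e$ on day $t$ after growing but before $\pi(t)$ is cut, i.e. $h^\pi_1(e)=g(e)$, and $h^\pi_{t+1}(e)=g(e)$ if $e\in\pi(t)$, $h^\pi_{t+1}(e)=h^\pi_t(e)+g(e)$ otherwise. The height of $\pi$ is $h(\pi)=\max_{e\in E}\sup_{t\in\mathbb{N}}h^\pi_t(e)$. -}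

module Defs where

open import Data.Bool using (if_then_else_)
open import Data.Fin using (Fin)
open import Data.Fin.Subset using (Subset; _∈_)
open import Data.Fin.Subset.Properties using (_∈?_)
open import Data.Integer as ℤ using (ℤ; +_; -[1+_])
import Data.Integer.Properties as ℤ
open import Data.List using (List; filter; foldr; map)
open import Data.List.Membership.Propositional using () renaming (_∈_ to _∈ˡ_)
open import Data.List.Relation.Unary.Unique.Propositional using (Unique)
open import Data.Nat as ℕ using (ℕ; zero; suc; z≤n; s≤s)
import Data.Nat.Properties as ℕ
open import Data.Nat.Tactic.RingSolver using (solve-∀)
open import Data.Product using (_×_; _,_; ∃; ∃-syntax)
open import Data.Rational
import Data.Rational.Properties as ℚ
import Data.Rational.Unnormalised as ℚᵘ
import Data.Rational.Unnormalised.Properties as ℚᵘ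
open import Relation.Binary.PropositionalEquality
open import Relation.Nullary using (does; contradiction)

-- An extended real x ∈ [-∞, ∞], given by its lower cut {q ∈ ℚ | q < x}.
-- Unlike two-sided cuts, lower cuts have all suprema constructively; the
-- empty cut is -∞ and the full cut is ∞.
record LowerReal : Set₁ where
  field
    Below  : ℚ → Set
    down   : ∀ {p q} → p < q → Below q → Below p
    open-ˡ : ∀ {p} → Below p → ∃[ q ] p < q × Below q

open LowerReal public

infix 4 _≤ᴸ_
_≤ᴸ_ : LowerReal → LowerReal → Set
x ≤ᴸ y = ∀ q → Below x q → Below y q

fromℚ : ℚ → LowerReal
fromℚ r = record { Below = _< r ; down = ℚ.<-trans ; open-ˡ = ℚ.<-dense }

⨆ : {A : Set} → (A → LowerReal) → LowerReal
⨆ x = record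
  { Below  = λ q → ∃[ a ] Below (x a) q
  ; down   = λ { p<q (a , b) → a , down (x a) p<q b }
  ; open-ˡ = λ { (a , b) → let (q , p<q , b′) = open-ˡ (x a) b
                           in q , p<q , a , b′ }
  }

infixr 7 _·_
_·_ : (c : ℚ) .{{_ : Positive c}} → LowerReal → LowerReal
c · x = record
  { Below  = λ q → Below x (q ÷ c)
  ; down   = λ p<q → down x (ℚ.*-monoˡ-<-pos (1/ c) p<q)
  ; open-ˡ = λ {p} b →
      let (q , p÷c<q , b′) = open-ˡ x b
      in q * c
       , subst (_< q * c) (cancel p (1/ c) c (ℚ.*-inverseˡ c))
           (ℚ.*-monoˡ-<-pos c p÷c<q)
       , subst (Below x) (sym (cancel q c (1/ c) (ℚ.*-inverseʳ c))) b′
  }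
  where
  instance
    c≢0 : NonZero c
    c≢0 = ℚ.pos⇒nonZero c
    1/c>0 : Positive (1/ c)
    1/c>0 = ℚ.1/pos⇒pos c
  cancel : ∀ p u v → u * v ≡ 1ℚ → p * u * v ≡ p
  cancel p u v uv≡1 =
    trans (ℚ.*-assoc p u v) (trans (cong (p *_) uv≡1) (ℚ.*-identityʳ p))

-- a / d < log₂ n, that is, 2 ^ a < n ^ d (for d ≥ 1); a negative power of 2
-- is moved to the other side.
infix 4 _over_<log₂_
_over_<log₂_ : ℤ → ℕ → ℕ → Set
(+ a)    over d <log₂ n = 2 ℕ.^ a ℕ.< n ℕ.^ d
-[1+ a ] over d <log₂ n = 1 ℕ.< 2 ℕ.^ suc a ℕ.* n ℕ.^ d

private
  <log₂⇒nonZero : ∀ p d n .{{_ : ℕ.NonZero d}} → p over d <log₂ n → ℕ.NonZero n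
  <log₂⇒nonZero p        d       (suc n) _ = _
  <log₂⇒nonZero -[1+ a ] (suc d) zero    h =
    contradiction (subst (1 ℕ.<_) (ℕ.*-zeroʳ (2 ℕ.^ suc a)) h) λ ()

  negative<log₂ : ∀ a d n .{{_ : ℕ.NonZero n}} → -[1+ a ] over d <log₂ n
  negative<log₂ a d n =
    ℕ.*-mono-≤ (ℕ.*-monoʳ-≤ 2 (ℕ.m^n>0 2 a)) (ℕ.m^n>0 n d)

  <log₂-down : ∀ p d p′ d′ n .{{_ : ℕ.NonZero d}} .{{_ : ℕ.NonZero d′}} →
    p ℤ.* + d′ ℤ.≤ p′ ℤ.* + d → p′ over d′ <log₂ n → p over d <log₂ n
  <log₂-down -[1+ a ] d p′ d′ n le h =
    negative<log₂ a d n {{<log₂⇒nonZero p′ d′ n h}}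
  <log₂-down (+ a) (suc d) -[1+ a′ ] d′ n le h =
    contradiction (subst (ℤ._≤ -[1+ a′ ] ℤ.* + suc d) (sym (ℤ.pos-* a d′)) le) λ ()
  <log₂-down (+ a) d (+ a′) d′ n le h = ℕ.≰⇒> λ n^d≤2^a →
    ℕ.<⇒≱ (ℕ.^-monoˡ-< d h) (begin
      (n ℕ.^ d′) ℕ.^ d   ≡⟨ ℕ.^-*-assoc n d′ d ⟩
      n ℕ.^ (d′ ℕ.* d)   ≡⟨ cong (n ℕ.^_) (ℕ.*-comm d′ d) ⟩
      n ℕ.^ (d ℕ.* d′)   ≡⟨ ℕ.^-*-assoc n d d′ ⟨
      (n ℕ.^ d) ℕ.^ d′   ≤⟨ ℕ.^-monoˡ-≤ d′ n^d≤2^a ⟩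
      (2 ℕ.^ a) ℕ.^ d′   ≡⟨ ℕ.^-*-assoc 2 a d′ ⟩
      2 ℕ.^ (a ℕ.* d′)   ≤⟨ ℕ.^-monoʳ-≤ 2 ad′≤a′d ⟩
      2 ℕ.^ (a′ ℕ.* d)   ≡⟨ ℕ.^-*-assoc 2 a′ d ⟨
      (2 ℕ.^ a′) ℕ.^ d   ∎)
    where
    open ℕ.≤-Reasoning
    ad′≤a′d : a ℕ.* d′ ℕ.≤ a′ ℕ.* d
    ad′≤a′d = ℤ.drop‿+≤+ (subst₂ ℤ._≤_ (sym (ℤ.pos-* a d′)) (sym (ℤ.pos-* a′ d)) le)

  bernoulli : ∀ x m → x ℕ.^ m ℕ.* (x ℕ.+ m) ℕ.≤ suc x ℕ.^ m ℕ.* x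
  bernoulli x zero    = ℕ.≤-reflexive (cong (1 ℕ.*_) (ℕ.+-identityʳ x))
  bernoulli x (suc m) = begin
    x ℕ.* x ℕ.^ m ℕ.* (x ℕ.+ suc m)
      ≤⟨ ℕ.m≤m+n _ (x ℕ.^ m ℕ.* m) ⟩
    x ℕ.* x ℕ.^ m ℕ.* (x ℕ.+ suc m) ℕ.+ x ℕ.^ m ℕ.* m
      ≡⟨ regroup x m (x ℕ.^ m) ⟩
    suc x ℕ.* (x ℕ.^ m ℕ.* (x ℕ.+ m))
      ≤⟨ ℕ.*-monoʳ-≤ (suc x) (bernoulli x m) ⟩
    suc x ℕ.* (suc x ℕ.^ m ℕ.* x)
      ≡⟨ ℕ.*-assoc (suc x) (suc x ℕ.^ m) x ⟨
    suc x ℕ.* suc x ℕ.^ m ℕ.* x ∎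
    where
    open ℕ.≤-Reasoning
    regroup : ∀ x m y → x ℕ.* y ℕ.* (x ℕ.+ (1 ℕ.+ m)) ℕ.+ y ℕ.* m
                      ≡ (1 ℕ.+ x) ℕ.* (y ℕ.* (x ℕ.+ m))
    regroup = solve-∀

  amplify : ∀ x y .{{_ : ℕ.NonZero x}} → x ℕ.< y →
    2 ℕ.* x ℕ.^ suc x ℕ.< y ℕ.^ suc x
  amplify x y x<y =
    ℕ.<-≤-trans (ℕ.*-cancelʳ-< x _ _ step) (ℕ.^-monoˡ-≤ (suc x) x<y)
    where
    open ℕ.≤-Reasoning
    z = x ℕ.^ suc x
    regroup : ∀ x z → z ℕ.* (x ℕ.+ (1 ℕ.+ x)) ≡ z ℕ.+ 2 ℕ.* z ℕ.* x
    regroup = solve-∀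
    step : 2 ℕ.* z ℕ.* x ℕ.< suc x ℕ.^ suc x ℕ.* x
    step = begin-strict
      2 ℕ.* z ℕ.* x             <⟨ ℕ.m<n+m _ (ℕ.m^n>0 x (suc x)) ⟩
      z ℕ.+ 2 ℕ.* z ℕ.* x       ≡⟨ regroup x z ⟨
      z ℕ.* (x ℕ.+ suc x)       ≤⟨ bernoulli x (suc x) ⟩
      suc x ℕ.^ suc x ℕ.* x     ∎

  <log₂-open : ∀ n p → ↥ p over ↧ₙ p <log₂ n →
    ∃[ q ] p < q × ↥ q over ↧ₙ q <log₂ n
  <log₂-open n p@(mkℚ -[1+ a ] d-1 _) h
    with ℚ.<-dense {p} {0ℚ} (ℚ.negative⁻¹ p)
  ... | q@(mkℚ -[1+ b ] e-1 _) , p<q , q<0 =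
    q , p<q , negative<log₂ b (suc e-1) n {{<log₂⇒nonZero -[1+ a ] (suc d-1) n h}}
  ... | q@(mkℚ (+ b) e-1 _) , p<q , q<0 =
    contradiction (ℚ.<-≤-trans q<0 (ℚ.nonNegative⁻¹ q)) (ℚ.<-irrefl refl)
  <log₂-open n p@(mkℚ (+ a) d-1 _) h =
    fromℚᵘ r , p<q ,
    <log₂-down (↥ fromℚᵘ r) (↧ₙ fromℚᵘ r) (+ a′) (suc e-1) n
      (cross (fromℚᵘ r) (ℚ.toℚᵘ-fromℚᵘ r)) below
    where
    d   = suc d-1
    m   = suc (2 ℕ.^ a)
    a′  = suc (a ℕ.* m)
    e-1 = 2 ℕ.^ a ℕ.+ d-1 ℕ.* m
    r : ℚᵘ.ℚᵘ
    r = ℚᵘ.mkℚᵘ (+ a′) e-1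

    cross : ∀ q → toℚᵘ q ℚᵘ.≃ r → ↥ q ℤ.* + suc e-1 ℤ.≤ + a′ ℤ.* ↧ q
    cross record{} q≃r = ℚᵘ.drop-*≤* (ℚᵘ.≤-reflexive q≃r)

    below : (+ a′) over suc e-1 <log₂ n
    below = subst₂ ℕ._<_
      (cong (2 ℕ.*_) (ℕ.^-*-assoc 2 a m)) (ℕ.^-*-assoc n d m)
      (amplify (2 ℕ.^ a) (n ℕ.^ d) {{ℕ.m^n≢0 2 a}} h)

    num : a ℕ.* (d ℕ.* m) ℕ.< a′ ℕ.* d
    num = subst (ℕ._< a′ ℕ.* d) (regroup a m d) (ℕ.m<n+m _ (s≤s z≤n))
      where
      regroup : ∀ a m d → a ℕ.* m ℕ.* d ≡ a ℕ.* (d ℕ.* m)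
      regroup = solve-∀

    p<q : p < fromℚᵘ r
    p<q = ℚ.toℚᵘ-cancel-< (ℚᵘ.<-respʳ-≃ (ℚᵘ.≃-sym (ℚ.toℚᵘ-fromℚᵘ r))
      (ℚᵘ.*<* (subst₂ ℤ._<_ (ℤ.pos-* a (d ℕ.* m)) (ℤ.pos-* a′ d) (ℤ.+<+ num))))

-- With log₂ 0 = -∞.
log₂ : ℕ → LowerReal
log₂ n = record
  { Below  = λ q → ↥ q over ↧ₙ q <log₂ n
  ; down   = λ {p} {q} p<q →
      <log₂-down (↥ p) (↧ₙ p) (↥ q) (↧ₙ q) n (ℚ.drop-*≤* (ℚ.<⇒≤ p<q))
  ; open-ˡ = <log₂-open n _
  }

∑ : {A : Set} → List A → (A → ℚ) → ℚ
∑ xs f = foldr _+_ 0ℚ (map f xs)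

-- The set of bamboos is Fin size; the family ℐ is a duplicate-free list of
-- subsets. Taking the coefficients w in ℚ loses nothing: as g is rational, a
-- linear system with a real solution also has a rational one.
record CBGT : Set where
  field
    size     : ℕ
    ℐ        : List (Subset size)
    ℐ-unique : Unique ℐ
    g        : Fin size → ℚ
    g≥0      : ∀ e → 0ℚ ≤ g e
    g-hull   : ∃[ w ] (∀ I → I ∈ˡ ℐ → 0ℚ ≤ w I)
                    × ∑ ℐ w ≡ 1ℚ
                    × (∀ e → g e ≡ ∑ (filter (e ∈?_) ℐ) w)

open CBGT public

-- Indexed from 0: π t is the set cut on day t + 1.
Schedule : CBGT → Set
Schedule G = ℕ → Subset (size G)

Valid : (G : CBGT) → Schedule G → Set
Valid G π = ∀ t → π t ∈ˡ ℐ G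

-- The height on day t + 1, after growing and before cutting.
heightAt : (G : CBGT) → Schedule G → ℕ → Fin (size G) → ℚ
heightAt G π zero    e = g G e
heightAt G π (suc t) e =
  if does (e ∈? π t) then g G e else heightAt G π t e + g G e

-- The maximum over the finitely many bamboos is taken as a supremum.
height : (G : CBGT) → Schedule G → LowerReal
height G π = ⨆ λ e → ⨆ λ t → fromℚ (heightAt G π t e)

{-# OPTIONS --safe #-}

-- The bamboos are the k-element subsets of a 2k-element set, and the sets that
-- may be cut are the stars: the i-th star consists of the k-subsets containing
-- i. All stars get the same coefficient 1/2k, so every bamboo grows at rate
-- 1/2. The stars cut on the first k - 1 days are given by at most k - 1 points,
-- so some k-subset avoids all of these points and has height k/2 on day k. On
-- the other hand C(2k, k) ≤ 2^(2k), so that log₂ n / 4 ≤ k/2.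
module Submission where

open import Defs
open import Data.Fin using (Fin; zero; suc)
import Data.Fin as Fin
open import Data.Fin.Subset
open import Data.Fin.Subset.Properties
open import Data.Integer using (+_; -[1+_])
import Data.Integer as ℤ
import Data.Integer.Properties as ℤ
open import Data.List using (List; []; _∷_; _++_; map; length; lookup; filter; tabulate)
open import Data.List.Membership.Propositional using () renaming (_∈_ to _∈ˡ_)
open import Data.List.Membership.Propositional.Properties
  using (∈-map⁺; ∈-map⁻; ∈-++⁺ˡ; ∈-++⁺ʳ; ∈-++⁻; ∈-lookup; ∈-tabulate⁻)
open import Data.List.Properties using (length-++; length-map; length-tabulate)
open import Data.List.Relation.Unary.Any using (here; index)
open import Data.List.Relation.Unary.Any.Properties using (lookup-index)
import Data.List.Relation.Unary.Unique.Propositional.Properties as Unique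
open import Data.Nat using (ℕ; zero; suc; _≥_; _*_; z≤n; s≤s; z<s)
import Data.Nat as ℕ
open import Data.Nat.Combinatorics using (_C_; nCk+nC[k+1]≡[n+1]C[k+1])
import Data.Nat.Properties as ℕ
open import Data.Nat.Tactic.RingSolver using (solve-∀)
open import Data.Product using (∃-syntax; _×_; _,_; proj₁; proj₂)
open import Data.Rational using (ℚ; mkℚ; _/_; Positive; toℚᵘ)
import Data.Rational as ℚ
import Data.Rational.Properties as ℚ
import Data.Rational.Unnormalised as ℚᵘ
import Data.Rational.Unnormalised.Properties as ℚᵘ
open import Data.Sum using (inj₁; inj₂)
import Data.Vec as Vec
open import Data.Vec using ([]; _∷_)
open import Data.Vec.Properties using (lookup∘tabulate; lookup⇒[]=; []=⇒lookup)
open import Function using (_∘_; _⇔_; mk⇔; Equivalence)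
open import Relation.Binary.PropositionalEquality
open import Relation.Nullary using (yes; no; contradiction)
open import Relation.Nullary.Decidable using (dec-false)
open import Relation.Unary using (Decidable)

open Equivalence using (to; from)

private
  variable
    n : ℕ

-- Enumerating and counting the subsets of a given size.

combinations : ∀ n (k : ℕ) → List (Subset n)
combinations zero    zero    = [] ∷ []
combinations zero    (suc k) = []
combinations (suc n) zero    = map (outside ∷_) (combinations n zero)
combinations (suc n) (suc k) =
  map (inside ∷_) (combinations n k) ++ map (outside ∷_) (combinations n (suc k))

length-combinations-suc : ∀ n k → length (combinations (suc n) (suc k)) ≡
  length (combinations n k) ℕ.+ length (combinations n (suc k))
length-combinations-suc n k = trans
  (length-++ (map (inside ∷_) (combinations n k)))
  (cong₂ ℕ._+_ (length-map _ (combinations n k)) (length-map _ (combinations n (suc k))))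

length-combinations : ∀ n k → length (combinations n k) ≡ n C k
length-combinations zero    zero    = refl
length-combinations zero    (suc k) = refl
length-combinations (suc n) zero    =
  trans (length-map _ (combinations n zero)) (length-combinations n zero)
length-combinations (suc n) (suc k) = begin
  length (combinations (suc n) (suc k))
    ≡⟨ length-combinations-suc n k ⟩
  length (combinations n k) ℕ.+ length (combinations n (suc k))
    ≡⟨ cong₂ ℕ._+_ (length-combinations n k) (length-combinations n (suc k)) ⟩
  n C k ℕ.+ n C suc k
    ≡⟨ nCk+nC[k+1]≡[n+1]C[k+1] n k ⟩
  suc n C suc k ∎
  where open ≡-Reasoning

-- Pascal's rule splits the count into two numbers, each at most `2 ^ n` by induction. On `2k`
-- points this bounds the logarithm of the number of bamboos by `2k`.
length-combinations≤2^n : ∀ n k → length (combinations n k) ℕ.≤ 2 ℕ.^ n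
length-combinations≤2^n zero    zero    = ℕ.≤-refl
length-combinations≤2^n zero    (suc k) = z≤n
length-combinations≤2^n (suc n) zero    = begin
  length (map (outside ∷_) (combinations n zero)) ≡⟨ length-map _ (combinations n zero) ⟩
  length (combinations n zero)                    ≤⟨ length-combinations≤2^n n zero ⟩
  2 ℕ.^ n                                         ≤⟨ ℕ.m≤m+n _ _ ⟩
  2 ℕ.^ suc n                                     ∎
  where open ℕ.≤-Reasoning
length-combinations≤2^n (suc n) (suc k) = begin
  length (combinations (suc n) (suc k))
    ≡⟨ length-combinations-suc n k ⟩
  length (combinations n k) ℕ.+ length (combinations n (suc k))
    ≤⟨ ℕ.+-mono-≤ (length-combinations≤2^n n k) (length-combinations≤2^n n (suc k)) ⟩
  2 ℕ.^ n ℕ.+ 2 ℕ.^ n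
    ≡⟨ cong (2 ℕ.^ n ℕ.+_) (ℕ.+-identityʳ _) ⟨
  2 ℕ.^ suc n ∎
  where open ℕ.≤-Reasoning

∈-combinations⁺ : (p : Subset n) → p ∈ˡ combinations n ∣ p ∣
∈-combinations⁺ []            = here refl
∈-combinations⁺ (inside  ∷ p) = ∈-++⁺ˡ (∈-map⁺ (inside ∷_) (∈-combinations⁺ p))
-- The list for `outside ∷ p` unfolds only once the size is known to be zero or a successor, so
-- `∣ p ∣` is abstracted together with the induction hypothesis.
∈-combinations⁺ (outside ∷ p) with ∣ p ∣ | ∈-combinations⁺ p
... | zero  | p∈ = ∈-map⁺ (outside ∷_) p∈
... | suc k | p∈ = ∈-++⁺ʳ (map (inside ∷_) (combinations _ k)) (∈-map⁺ (outside ∷_) p∈)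

∈-combinations⁻ : ∀ k {p : Subset n} → p ∈ˡ combinations n k → ∣ p ∣ ≡ k
∈-combinations⁻ {zero}  zero    (here refl) = refl
∈-combinations⁻ {suc n} zero    p∈ with ∈-map⁻ (outside ∷_) p∈
... | _ , q∈ , refl = ∈-combinations⁻ zero q∈
∈-combinations⁻ {suc n} (suc k) p∈ with ∈-++⁻ (map (inside ∷_) (combinations n k)) p∈
... | inj₁ p∈ˡ with ∈-map⁻ (inside ∷_) p∈ˡ
...   | _ , q∈ , refl = cong suc (∈-combinations⁻ k q∈)
∈-combinations⁻ {suc n} (suc k) p∈ | inj₂ p∈ʳ with ∈-map⁻ (outside ∷_) p∈ʳ
...   | _ , q∈ , refl = ∈-combinations⁻ (suc k) q∈

-- Subsets of intermediate size and sizes of unions.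

between : ∀ (p q : Subset n) m → p ⊆ q → ∣ p ∣ ℕ.≤ m → m ℕ.≤ ∣ q ∣ →
  ∃[ r ] p ⊆ r × r ⊆ q × ∣ r ∣ ≡ m
between []            []            zero    p⊆q _ _ = [] , p⊆q , p⊆q , refl
between (inside  ∷ p) (outside ∷ q) m       p⊆q _ _ with () ← p⊆q Vec.here
between (inside  ∷ p) (inside  ∷ q) (suc m) p⊆q (s≤s l) (s≤s u) =
  let r , p⊆r , r⊆q , ∣r∣≡m = between p q m (drop-∷-⊆ p⊆q) l u
  in inside ∷ r , s⊆s p⊆r , s⊆s r⊆q , cong suc ∣r∣≡m
between (outside ∷ p) (outside ∷ q) m       p⊆q l u =
  let r , p⊆r , r⊆q , ∣r∣≡m = between p q m (drop-∷-⊆ p⊆q) l u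
  in outside ∷ r , s⊆s p⊆r , s⊆s r⊆q , ∣r∣≡m
-- A point of the upper set outside the lower one is dropped as long as the rest still has `m`
-- elements. Otherwise the upper set has exactly `m` elements and is itself the answer.
between (outside ∷ p) (inside  ∷ q) m       p⊆q l u with m ℕ.≤? ∣ q ∣
... | yes m≤∣q∣ =
  let r , p⊆r , r⊆q , ∣r∣≡m = between p q m (drop-∷-⊆ p⊆q) l m≤∣q∣
  in outside ∷ r , s⊆s p⊆r , out⊆ r⊆q , ∣r∣≡m
... | no m≰∣q∣ =
  inside ∷ q , p⊆q , ⊆-refl , ℕ.≤-antisym (ℕ.≰⇒> m≰∣q∣) u

∣p∪q∣≤∣p∣+∣q∣ : ∀ (p q : Subset n) → ∣ p ∪ q ∣ ℕ.≤ ∣ p ∣ ℕ.+ ∣ q ∣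
∣p∪q∣≤∣p∣+∣q∣ []            []            = z≤n
∣p∪q∣≤∣p∣+∣q∣ (outside ∷ p) (outside ∷ q) = ∣p∪q∣≤∣p∣+∣q∣ p q
∣p∪q∣≤∣p∣+∣q∣ (outside ∷ p) (inside  ∷ q) =
  ℕ.≤-trans (s≤s (∣p∪q∣≤∣p∣+∣q∣ p q)) (ℕ.≤-reflexive (sym (ℕ.+-suc ∣ p ∣ ∣ q ∣)))
∣p∪q∣≤∣p∣+∣q∣ (inside  ∷ p) (t       ∷ q) =
  s≤s (ℕ.≤-trans (∣p∪q∣≤∣p∣+∣q∣ p q) (ℕ.+-monoʳ-≤ ∣ p ∣ (∣p∣≤∣x∷p∣ t q)))

firstValues : (ℕ → Fin n) → ℕ → Subset n
firstValues f zero    = ⊥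
firstValues f (suc t) = firstValues f t ∪ ⁅ f t ⁆

∣firstValues∣≤ : ∀ (f : ℕ → Fin n) t → ∣ firstValues f t ∣ ℕ.≤ t
∣firstValues∣≤ {n} f zero    = ℕ.≤-reflexive (∣⊥∣≡0 n)
∣firstValues∣≤     f (suc t) = begin
  ∣ firstValues f t ∪ ⁅ f t ⁆ ∣           ≤⟨ ∣p∪q∣≤∣p∣+∣q∣ (firstValues f t) ⁅ f t ⁆ ⟩
  ∣ firstValues f t ∣ ℕ.+ ∣ ⁅ f t ⁆ ∣     ≡⟨ cong (∣ firstValues f t ∣ ℕ.+_) (∣⁅x⁆∣≡1 (f t)) ⟩
  ∣ firstValues f t ∣ ℕ.+ 1               ≤⟨ ℕ.+-monoˡ-≤ 1 (∣firstValues∣≤ f t) ⟩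
  t ℕ.+ 1                                 ≡⟨ ℕ.+-comm t 1 ⟩
  suc t                                   ∎
  where open ℕ.≤-Reasoning

-- The order `<′` is generated by raising its upper bound, so its constructors match the recursion
-- of `firstValues` on `t`.
∈-firstValues : ∀ (f : ℕ → Fin n) {s t} → s ℕ.<′ t → f s ∈ firstValues f t
∈-firstValues f {s} (ℕ.≤′-reflexive refl) = q⊆p∪q (firstValues f s) _ (x∈⁅x⁆ (f s))
∈-firstValues f (ℕ.≤′-step s<t)           = p⊆p∪q _ (∈-firstValues f s<t)

-- Applied to the list of stars, with `p` the point set of a bamboo, this counts the stars through
-- that bamboo.
length-filter-tabulate : ∀ {A : Set} {P : A → Set} (P? : Decidable P)
  (f : Fin n → A) (p : Subset n) → (∀ i → P (f i) ⇔ i ∈ p) →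
  length (filter P? (tabulate f)) ≡ ∣ p ∣
length-filter-tabulate P? f []      Pf⇔∈p = refl
length-filter-tabulate P? f (s ∷ p) Pf⇔∈p
  with P? (f zero) | length-filter-tabulate P? (f ∘ suc) p
    (λ i → mk⇔ (drop-there ∘ to (Pf⇔∈p (suc i))) (from (Pf⇔∈p (suc i)) ∘ Vec.there))
length-filter-tabulate P? f (inside  ∷ p) Pf⇔∈p | yes _ | eq = cong suc eq
length-filter-tabulate P? f (inside  ∷ p) Pf⇔∈p | no ¬P | eq =
  contradiction (from (Pf⇔∈p zero) Vec.here) ¬P
length-filter-tabulate P? f (outside ∷ p) Pf⇔∈p | yes P | eq
  with () ← to (Pf⇔∈p zero) P
length-filter-tabulate P? f (outside ∷ p) Pf⇔∈p | no _  | eq = eq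

-- Arithmetic of fractions with natural numerators.

+-/ : ∀ d .{{_ : ℕ.NonZero d}} a b → + a / d ℚ.+ + b / d ≡ + (a ℕ.+ b) / d
+-/ (suc d-1) a b = ℚ.toℚᵘ-injective (begin
  toℚᵘ (+ a / e ℚ.+ + b / e)           ≈⟨ ℚ.toℚᵘ-homo-+ (+ a / e) (+ b / e) ⟩
  toℚᵘ (+ a / e) ℚᵘ.+ toℚᵘ (+ b / e)   ≈⟨ ℚᵘ.+-cong (toℚᵘ-/ a) (toℚᵘ-/ b) ⟩
  mk a ℚᵘ.+ mk b                       ≈⟨ ℚᵘ.*≡* cross ⟩
  mk (a ℕ.+ b)                         ≈⟨ toℚᵘ-/ (a ℕ.+ b) ⟨
  toℚᵘ (+ (a ℕ.+ b) / e)               ∎)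
  where
  open ℚᵘ.≃-Reasoning
  e = suc d-1
  mk : ℕ → ℚᵘ.ℚᵘ
  mk c = ℚᵘ.mkℚᵘ (+ c) d-1
  toℚᵘ-/ : ∀ c → toℚᵘ (+ c / e) ℚᵘ.≃ mk c
  toℚᵘ-/ c = ℚ.toℚᵘ-fromℚᵘ (mk c)
  cross : (+ a ℤ.* + e ℤ.+ + b ℤ.* + e) ℤ.* + e ≡ + (a ℕ.+ b) ℤ.* (+ e ℤ.* + e)
  cross = trans
    (cong (ℤ._* + e) (sym (ℤ.*-distribʳ-+ (+ e) (+ a) (+ b))))
    (ℤ.*-assoc (+ (a ℕ.+ b)) (+ e) (+ e))

∑-const : ∀ d .{{_ : ℕ.NonZero d}} {A : Set} (xs : List A) → ∑ xs (λ _ → + 1 / d) ≡ + length xs / d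
∑-const d []       = sym (ℚ.0/n≡0 d)
∑-const d (x ∷ xs) = trans (cong (+ 1 / d ℚ.+_) (∑-const d xs)) (+-/ d 1 (length xs))

/-cross : ∀ a b c d .{{_ : ℕ.NonZero b}} .{{_ : ℕ.NonZero d}} →
  a * d ≡ c * b → + a / b ≡ + c / d
/-cross a (suc b) c (suc d) ad≡cb = ℚ.fromℚᵘ-cong {ℚᵘ.mkℚᵘ (+ a) b} {ℚᵘ.mkℚᵘ (+ c) d}
  (ℚᵘ.*≡* (trans (sym (ℤ.pos-* a (suc d))) (trans (cong +_ ad≡cb) (ℤ.pos-* c (suc b)))))

integer*1/ : ∀ m d .{{_ : ℕ.NonZero d}} → (+ m / 1) ℚ.* (+ 1 / d) ≡ + m / d
integer*1/ m (suc d-1) = ℚ.toℚᵘ-injective (begin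
  toℚᵘ ((+ m / 1) ℚ.* (+ 1 / d))       ≈⟨ ℚ.toℚᵘ-homo-* (+ m / 1) (+ 1 / d) ⟩
  toℚᵘ (+ m / 1) ℚᵘ.* toℚᵘ (+ 1 / d)
    ≈⟨ ℚᵘ.*-cong (ℚ.toℚᵘ-fromℚᵘ (mk m 0)) (ℚ.toℚᵘ-fromℚᵘ (mk 1 d-1)) ⟩
  mk m 0 ℚᵘ.* mk 1 d-1                 ≈⟨ ℚᵘ.*≡* cross ⟩
  mk m d-1                             ≈⟨ ℚ.toℚᵘ-fromℚᵘ (mk m d-1) ⟨
  toℚᵘ (+ m / d)                       ∎)
  where
  open ℚᵘ.≃-Reasoning
  d = suc d-1
  mk : ℕ → ℕ → ℚᵘ.ℚᵘ
  mk a b = ℚᵘ.mkℚᵘ (+ a) b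
  cross : + m ℤ.* + 1 ℤ.* + d ≡ + m ℤ.* (+ 1 ℤ.* + d)
  cross = ℤ.*-assoc (+ m) (+ 1) (+ d)

-- Upper bounds for lower reals.

log₂-2^ : ∀ {N} m → N ℕ.≤ 2 ℕ.^ m → log₂ N ≤ᴸ fromℚ (+ m / 1)
log₂-2^ m N≤2^m q@(mkℚ -[1+ _ ] _ _) _ =
  ℚ.<-≤-trans (ℚ.negative⁻¹ q)
    (ℚ.nonNegative⁻¹ (+ m / 1) {{ℚ.normalize-nonNeg m 1}})
log₂-2^ {N} m N≤2^m q@(mkℚ (+ a) d-1 _) 2^a<N^d =
  ℚ.toℚᵘ-cancel-< (ℚᵘ.<-respʳ-≃ (ℚᵘ.≃-sym (ℚ.toℚᵘ-fromℚᵘ (ℚᵘ.mkℚᵘ (+ m) 0)))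
    (ℚᵘ.*<* (subst₂ ℤ._<_ (sym (ℤ.*-identityʳ (+ a))) (ℤ.pos-* m d) (ℤ.+<+ a<md))))
  where
  open ℕ.≤-Reasoning
  d = suc d-1
  a<md : a ℕ.< m * d
  -- The cut at `a / d` says `2 ^ a < N ^ d`, while `N ^ d` is at most `2 ^ (m * d)`; comparing
  -- exponents gives the claim.
  a<md = ℕ.≰⇒> λ md≤a → ℕ.<⇒≱ 2^a<N^d (begin
    N ℕ.^ d             ≤⟨ ℕ.^-monoˡ-≤ d N≤2^m ⟩
    (2 ℕ.^ m) ℕ.^ d     ≡⟨ ℕ.^-*-assoc 2 m d ⟩
    2 ℕ.^ (m * d)       ≤⟨ ℕ.^-monoʳ-≤ 2 md≤a ⟩
    2 ℕ.^ a             ∎)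

·-fromℚ : ∀ c .{{_ : Positive c}} r → c · fromℚ r ≤ᴸ fromℚ (r ℚ.* c)
·-fromℚ c r q q÷c<r = subst (ℚ._< r ℚ.* c) q÷c*c≡q (ℚ.*-monoˡ-<-pos c q÷c<r)
  where
  instance
    c≢0 : ℚ.NonZero c
    c≢0 = ℚ.pos⇒nonZero c
  q÷c*c≡q : q ℚ.÷ c ℚ.* c ≡ q
  q÷c*c≡q = trans (ℚ.*-assoc q (ℚ.1/ c) c)
    (trans (cong (q ℚ.*_) (ℚ.*-inverseˡ c)) (ℚ.*-identityʳ q))

-- The star instance for the `k`-subsets of `n` points.

module Stars (n k : ℕ) .{{_ : ℕ.NonZero n}} (1≤k : 1 ℕ.≤ k) (k<n : k ℕ.< n) where

  Bamboo : Set
  Bamboo = Fin (length (combinations n k))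

  points : Bamboo → Subset n
  points = lookup (combinations n k)

  ∣points∣ : ∀ e → ∣ points e ∣ ≡ k
  ∣points∣ e = ∈-combinations⁻ {n} k (∈-lookup e)

  bamboo : ∀ p → ∣ p ∣ ≡ k → ∃[ e ] points e ≡ p
  bamboo p refl = index (∈-combinations⁺ p) , sym (lookup-index (∈-combinations⁺ p))

  -- This is the column of the point `i` in the incidence matrix whose rows are the sets `points e`.
  star : Fin n → Subset (length (combinations n k))
  star i = Vec.tabulate λ e → Vec.lookup (points e) i

  ∈-star : ∀ e i → e ∈ star i ⇔ i ∈ points e
  ∈-star e i = mk⇔
    (λ e∈ → lookup⇒[]= i (points e) (trans (sym (lookup∘tabulate _ e)) ([]=⇒lookup e∈)))
    (λ i∈ → lookup⇒[]= e (star i) (trans (lookup∘tabulate _ e) ([]=⇒lookup i∈)))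

  -- For i ≢ j some k-subset contains i but not j.
  star-injective : ∀ {i j} → star i ≡ star j → i ≡ j
  star-injective {i} {j} star≡ with i Fin.≟ j
  ... | yes i≡j = i≡j
  ... | no  i≢j =
    let p , i⊆p , p⊆∁j , ∣p∣≡k = between ⁅ i ⁆ (∁ ⁅ j ⁆) k
          (λ x∈i → x∉p⇒x∈∁p λ x∈j → i≢j (trans (sym (x∈⁅y⁆⇒x≡y i x∈i)) (x∈⁅y⁆⇒x≡y j x∈j)))
          (ℕ.≤-trans (ℕ.≤-reflexive (∣⁅x⁆∣≡1 i)) 1≤k) k≤∣∁j∣
        e , points≡p = bamboo p ∣p∣≡k
        e∈i = from (∈-star e i) (subst (i ∈_) (sym points≡p) (i⊆p (x∈⁅x⁆ i)))
        j∈p = subst (j ∈_) points≡p (to (∈-star e j) (subst (e ∈_) star≡ e∈i))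
    in contradiction (x∈⁅x⁆ j) (x∈∁p⇒x∉p (p⊆∁j j∈p))
    where
    k≤∣∁j∣ : k ℕ.≤ ∣ ∁ ⁅ j ⁆ ∣
    k≤∣∁j∣ = subst (k ℕ.≤_)
      (sym (trans (∣∁p∣≡n∸∣p∣ ⁅ j ⁆) (cong (n ℕ.∸_) (∣⁅x⁆∣≡1 j)))) (ℕ.∸-monoˡ-≤ 1 k<n)

  starInstance : CBGT
  starInstance = record
    { size     = length (combinations n k)
    ; ℐ        = tabulate star
    -- The bounds `1 ≤ k` and `k < n` enter here, through `star-injective`.
    ; ℐ-unique = Unique.tabulate⁺ star-injective
    ; g        = λ _ → + k / n
    ; g≥0      = λ _ → ℚ.nonNegative⁻¹ (+ k / n) {{ℚ.normalize-nonNeg k n}}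
    ; g-hull   = (λ _ → + 1 / n)
               , (λ _ _ → ℚ.nonNegative⁻¹ (+ 1 / n) {{ℚ.normalize-nonNeg 1 n}})
               , trans (∑-const n (tabulate star))
                   (trans (cong (λ m → + m / n) (length-tabulate star))
                     (/-cross n n 1 1 (ℕ.*-comm n 1)))
               -- Exactly `k` stars contain `e`, one for each of its points, and each has weight
               -- `1 / n`.
               , λ e → sym (trans (∑-const n (filter (e ∈?_) (tabulate star)))
                   (cong (λ m → + m / n)
                     (trans (length-filter-tabulate (e ∈?_) star (points e) (∈-star e))
                       (∣points∣ e))))
    }

  -- Index `t` stands for day `t + 1` before cutting, so `t` days without a cut of `e` leave `t + 1`
  -- growth steps of `k / n` each.
  heightAt-uncut : ∀ π t e → (∀ {s} → s ℕ.<′ t → e ∉ π s) →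
    heightAt starInstance π t e ≡ + (suc t * k) / n
  heightAt-uncut π zero    e uncut = cong (λ m → + m / n) (sym (ℕ.*-identityˡ k))
  heightAt-uncut π (suc t) e uncut
    rewrite dec-false (e ∈? π t) (uncut ℕ.≤′-refl)
          | heightAt-uncut π t e (uncut ∘ ℕ.≤′-step)
    = trans (+-/ n (suc t * k) k) (cong (λ m → + m / n) (ℕ.+-comm (suc t * k) k))

  -- The first `t` stars have at most `t` centres, so at least `n - t`, hence at least `k`, points
  -- are not centres. Any `k` of these form a bamboo lying in none of the stars cut.
  ∃-uncut : ∀ π → Valid starInstance π → ∀ t → t ℕ.+ k ℕ.≤ n →
    ∃[ e ] (∀ {s} → s ℕ.<′ t → e ∉ π s)
  ∃-uncut π valid t t+k≤n =
    let p , _ , p⊆∁cut , ∣p∣≡k = between ⊥ (∁ cut) k ⊥⊆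
          (subst (ℕ._≤ k) (sym (∣⊥∣≡0 n)) z≤n) k≤∣∁cut∣
        e , points≡p = bamboo p ∣p∣≡k
    in e , λ {s} s<t e∈πs →
      let c∈p = to (∈-star e (centre s)) (subst (e ∈_) (proj₂ (∈-tabulate⁻ (valid s))) e∈πs)
      in x∈∁p⇒x∉p (p⊆∁cut (subst (centre s ∈_) points≡p c∈p)) (∈-firstValues centre s<t)
    where
    centre : ℕ → Fin n
    centre s = proj₁ (∈-tabulate⁻ (valid s))
    cut = firstValues centre t
    open ℕ.≤-Reasoning
    k≤∣∁cut∣ : k ℕ.≤ ∣ ∁ cut ∣
    k≤∣∁cut∣ = begin
      k                   ≡⟨ ℕ.m+n∸m≡n t k ⟨
      t ℕ.+ k ℕ.∸ t       ≤⟨ ℕ.∸-mono t+k≤n (∣firstValues∣≤ centre t) ⟩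
      n ℕ.∸ ∣ cut ∣       ≡⟨ ∣∁p∣≡n∸∣p∣ cut ⟨
      ∣ ∁ cut ∣           ∎

  height-≥ : ∀ π → Valid starInstance π → ∀ t → t ℕ.+ k ℕ.≤ n →
    fromℚ (+ (suc t * k) / n) ≤ᴸ height starInstance π
  height-≥ π valid t t+k≤n q q< =
    let e , uncut = ∃-uncut π valid t t+k≤n
    in e , t , subst (q ℚ.<_) (sym (heightAt-uncut π t e uncut)) q<

theorem5p3 : (k : ℕ) → k ≥ 1 →
    ∃[ G ] size G ≡ (2 * k) C k
    × ((π : Schedule G) → Valid G π →
    (+ 1 / 4) · log₂ (size G) ≤ᴸ height G π)
theorem5p3 (suc j) k≥1 =
  starInstance , length-combinations 2k k , λ π valid q q<¼log₂n →
    -- The choice `t = j` is day `k`, preceded by `k - 1` cuts. The summand `k + 0` appears because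
    -- `2 * k` unfolds to `k + (k + 0)`.
    height-≥ π valid j (ℕ.+-mono-≤ (ℕ.n≤1+n j) (ℕ.m≤m+n k 0)) q
      (subst (q ℚ.<_) 2k/4≡k²/2k
        (·-fromℚ (+ 1 / 4) (+ 2k / 1) q
          (log₂-2^ 2k (length-combinations≤2^n 2k k) _ q<¼log₂n)))
  where
  k = suc j
  2k = 2 * k
  open Stars 2k k k≥1 (ℕ.m<m+n k z<s)
  -- Both sides equal `k / 2`: on the left a quarter of the bound `2k` on the logarithm, on the
  -- right `k` growth steps at rate `k / 2k`.
  2k/4≡k²/2k : (+ 2k / 1) ℚ.* (+ 1 / 4) ≡ + (k * k) / 2k
  2k/4≡k²/2k = trans (integer*1/ 2k 4) (/-cross 2k 4 (k * k) 2k (square k))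
    where
    square : ∀ k → 2 * k * (2 * k) ≡ k * k * 4
    square = solve-∀
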